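{- Let $K/F$ be a computable field extension for which the degree map $\deg_F:K\to\mathbb{N}$ is computable, and let $C\subseteq\omega$ be a cohesive set. Assume further that $\{\deg_F(\alpha)\mid\alpha\in K\}$ is unbounded. Then $\prod_C K/\prod_C F$ is transcendental with infinite transcendence degree.
   Context: For $A,B\subseteq\omega$, $A\subseteq^* B$ means $A\setminus B$ is finite. A set $C\subseteq\omega$ is cohesive if it is infinite and for every c.e. set $W$ either $C\subseteq^*W$ or $C\subseteq^*\overline{W}$. A computable structure has computable domain $\subseteq\omega$ and computable atomic diagram. For a computable structure $\mathcal A$ and cohesive $C$, the cohesive power $\prod_C\mathcal A$ has as domain the classes $[\varphi]$ of partial computable functions $\varphi$ from $\omega$ to $\mathcal{A}$ with $C\subseteq^*\mathrm{dom}(\varphi)$, where $[\varphi]=[\psi]$ iff $C\subseteq^*\{i:\varphi(i){\downarrow}=\psi(i){\downarrow}\}$; functions and constants are interpreted pointwise. A computable field extension $K/F$ is a triple $(K,F,\Psi)$ with $K,F$ computable fields and $\Psi:F\to K$ a computable ring homomorphism; $F$ is identified with its image. $\prod_CF$ is regarded as a subfield of $\prod_CK$ via $[\alpha]\mapsto[\Psi\circ\alpha]$. For $\alpha\in K$ algebraic over $F$, $\deg_F(\alpha)=[F(\alpha):F]$ is the degree of its minimal polynomial; that the degree map is a function $K\to\mathbb{N}$ includes that every element of $K$ is algebraic over $F$. -}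

module Defs where

open import Level using (0ℓ)
open import Data.Nat.Base using (ℕ; zero; suc; pred; _∸_; _≤_; _<_)
import Data.Nat as ℕ
import Data.Nat.Properties as ℕ
open import Data.Fin.Base using (Fin; toℕ)
open import Data.Fin.Patterns using (0F; 1F; 2F)
open import Data.Vec.Base using (Vec; []; _∷_; lookup; tabulate)
open import Data.List.Base using (List; []; _∷_; _++_; foldr)
open import Data.List.Relation.Unary.All using (All)
import Data.List.Membership.Propositional as List
open import Data.List.Membership.DecPropositional ℕ._≟_ using (_∈?_)
open import Data.List.Membership.Propositional.Properties using (∈-++⁺ˡ; ∈-++⁺ʳ)
open import Data.Product.Base using (∃; ∃-syntax; _×_; _,_; proj₁; proj₂)
open import Data.Sum.Base using (_⊎_; inj₁; inj₂)
open import Data.Empty using (⊥; ⊥-elim)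
open import Function.Base using (_∘_)
open import Relation.Nullary using (¬_; yes; no)
open import Relation.Unary using (Pred; _∈_; ∁; _∖_)
open import Relation.Binary.Core using (Rel)
open import Relation.Binary.Structures using (IsEquivalence)
open import Relation.Binary.Definitions using (tri<; tri≈; tri>)
open import Relation.Binary.PropositionalEquality
  using (_≡_; refl; sym; trans; cong; cong₂; subst)
open import Algebra.Core using (Op₁; Op₂)
open import Algebra.Definitions using (Invertible)
open import Algebra.Structures using (IsCommutativeRing)
open import Algebra.Apartness.Structures using (IsHeytingField)
open import Algebra.Bundles using (CommutativeRing; RawRing)
open import Algebra.Apartness.Bundles using (HeytingField; HeytingCommutativeRing)
open import Algebra.Morphism.Structures using (module RingMorphisms)

private
  variable
    m n : ℕ

------------------------------------------------------------------------
-- Partial recursive functions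

-- Syntax of the n-ary μ-recursive functions.
data Code : ℕ → Set where
  zeroᶜ : Code n
  sucᶜ  : Code 1
  proj  : Fin n → Code n
  comp  : Code m → Vec (Code n) m → Code n
  rec   : Code n → Code (suc (suc n)) → Code (suc n)
  μ     : Code (suc n) → Code n

infix 4 _[_]⇓_ _[_]⇓*_

-- e [ xs ]⇓ v : the function with code e is defined at xs, with value v.
data _[_]⇓_  : Code n → Vec ℕ n → ℕ → Set
data _[_]⇓*_ : Vec (Code n) m → Vec ℕ n → Vec ℕ m → Set

data _[_]⇓_ where
  ⇓zero : ∀ {xs : Vec ℕ n} → zeroᶜ [ xs ]⇓ 0
  ⇓suc  : ∀ {x} → sucᶜ [ x ∷ [] ]⇓ suc x
  ⇓proj : ∀ {xs : Vec ℕ n} (j : Fin n) → proj j [ xs ]⇓ lookup xs j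
  ⇓comp : ∀ {e : Code m} {es : Vec (Code n) m} {xs ys v} →
          es [ xs ]⇓* ys → e [ ys ]⇓ v → comp e es [ xs ]⇓ v
  ⇓rec0 : ∀ {e : Code n} {e′ xs v} →
          e [ xs ]⇓ v → rec e e′ [ 0 ∷ xs ]⇓ v
  ⇓recS : ∀ {e : Code n} {e′ xs k r v} →
          rec e e′ [ k ∷ xs ]⇓ r → e′ [ k ∷ r ∷ xs ]⇓ v →
          rec e e′ [ suc k ∷ xs ]⇓ v
  ⇓μ    : ∀ {e : Code (suc n)} {xs y} →
          e [ y ∷ xs ]⇓ 0 →
          (∀ z → z < y → ∃[ w ] e [ z ∷ xs ]⇓ suc w) →
          μ e [ xs ]⇓ y

data _[_]⇓*_ where
  []  : ∀ {xs : Vec ℕ n} → [] [ xs ]⇓* []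
  _∷_ : ∀ {e : Code n} {es : Vec (Code n) m} {xs v vs} →
        e [ xs ]⇓ v → es [ xs ]⇓* vs → (e ∷ es) [ xs ]⇓* (v ∷ vs)

⇓-det  : ∀ {e : Code n} {xs v w} → e [ xs ]⇓ v → e [ xs ]⇓ w → v ≡ w
⇓*-det : ∀ {es : Vec (Code n) m} {xs vs ws} →
         es [ xs ]⇓* vs → es [ xs ]⇓* ws → vs ≡ ws

⇓-det ⇓zero ⇓zero = refl
⇓-det ⇓suc ⇓suc = refl
⇓-det (⇓proj j) (⇓proj .j) = refl
⇓-det (⇓comp d e) (⇓comp d′ e′) with refl ← ⇓*-det d d′ = ⇓-det e e′
⇓-det (⇓rec0 d) (⇓rec0 d′) = ⇓-det d d′
⇓-det (⇓recS d e) (⇓recS d′ e′) with refl ← ⇓-det d d′ = ⇓-det e e′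
⇓-det (⇓μ {y = y} d f) (⇓μ {y = y′} d′ f′) with ℕ.<-cmp y y′
... | tri< y<y′ _ _ with () ← ⇓-det d (proj₂ (f′ y y<y′))
... | tri≈ _ y≡y′ _ = y≡y′
... | tri> _ _ y′<y with () ← ⇓-det (proj₂ (f y′ y′<y)) d′

⇓*-det [] [] = refl
⇓*-det (d ∷ ds) (d′ ∷ ds′) = cong₂ _∷_ (⇓-det d d′) (⇓*-det ds ds′)

------------------------------------------------------------------------
-- Some recursive functions, needed below only to see that a cohesive
-- power of a field is a field

constᶜ : ℕ → Code n
constᶜ zero    = zeroᶜ
constᶜ (suc k) = comp sucᶜ (constᶜ k ∷ [])

constᶜ-⇓ : ∀ k {xs : Vec ℕ n} → constᶜ k [ xs ]⇓ k
constᶜ-⇓ zero    = ⇓zero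
constᶜ-⇓ (suc k) = ⇓comp (constᶜ-⇓ k ∷ []) ⇓suc

predᶜ : Code 1
predᶜ = rec zeroᶜ (proj 0F)

predᶜ-⇓ : ∀ k → predᶜ [ k ∷ [] ]⇓ pred k
predᶜ-⇓ zero    = ⇓rec0 ⇓zero
predᶜ-⇓ (suc k) = ⇓recS (predᶜ-⇓ k) (⇓proj 0F)

addᶜ : Code 2
addᶜ = rec (proj 0F) (comp sucᶜ (proj 1F ∷ []))

addᶜ-⇓ : ∀ k a → addᶜ [ k ∷ a ∷ [] ]⇓ k ℕ.+ a
addᶜ-⇓ zero    a = ⇓rec0 (⇓proj 0F)
addᶜ-⇓ (suc k) a = ⇓recS (addᶜ-⇓ k a) (⇓comp (⇓proj 1F ∷ []) ⇓suc)

subᶜ : Code 2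
subᶜ = rec (proj 0F) (comp predᶜ (proj 1F ∷ []))

subᶜ-⇓ : ∀ k a → subᶜ [ k ∷ a ∷ [] ]⇓ a ∸ k
subᶜ-⇓ zero    a = ⇓rec0 (⇓proj 0F)
subᶜ-⇓ (suc k) a = subst (subᶜ [ suc k ∷ a ∷ [] ]⇓_) (ℕ.pred[m∸n]≡m∸[1+n] a k)
  (⇓recS (subᶜ-⇓ k a) (⇓comp (⇓proj 1F ∷ []) (predᶜ-⇓ (a ∸ k))))

distᶜ : Code 2
distᶜ = comp addᶜ (comp subᶜ (proj 1F ∷ proj 0F ∷ []) ∷ subᶜ ∷ [])

distᶜ-⇓ : ∀ a b → distᶜ [ a ∷ b ∷ [] ]⇓ (a ∸ b) ℕ.+ (b ∸ a)
distᶜ-⇓ a b = ⇓comp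
  (⇓comp (⇓proj 1F ∷ ⇓proj 0F ∷ []) (subᶜ-⇓ b a) ∷ subᶜ-⇓ a b ∷ [])
  (addᶜ-⇓ (a ∸ b) (b ∸ a))

distᶜ-refl : ∀ a → distᶜ [ a ∷ a ∷ [] ]⇓ 0
distᶜ-refl a = subst (distᶜ [ a ∷ a ∷ [] ]⇓_)
  (cong₂ ℕ._+_ (ℕ.n∸n≡0 a) (ℕ.n∸n≡0 a)) (distᶜ-⇓ a a)

distᶜ-≡ : ∀ {a b} → distᶜ [ a ∷ b ∷ [] ]⇓ 0 → a ≡ b
distᶜ-≡ {a} {b} d = ℕ.≤-antisym
  (ℕ.m∸n≡0⇒m≤n (ℕ.m+n≡0⇒m≡0 (a ∸ b) eq))
  (ℕ.m∸n≡0⇒m≤n (ℕ.m+n≡0⇒n≡0 (a ∸ b) eq))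
  where eq = ⇓-det (distᶜ-⇓ a b) d

μ-search : ∀ {e : Code (suc n)} {xs} → (∀ z → ∃[ w ] e [ z ∷ xs ]⇓ w) →
           ∀ {y} → e [ y ∷ xs ]⇓ 0 → ∃[ y′ ] μ e [ xs ]⇓ y′
μ-search {e = e} {xs} total {y} d =
  go 0 y (subst (λ t → e [ t ∷ xs ]⇓ 0) (sym (ℕ.+-identityʳ y)) d) (λ _ ())
  where
  go : ∀ k f → e [ f ℕ.+ k ∷ xs ]⇓ 0 →
       (∀ z → z < k → ∃[ w ] e [ z ∷ xs ]⇓ suc w) → ∃[ y′ ] μ e [ xs ]⇓ y′
  go k f d below with total k
  ... | zero , d′ = k , ⇓μ d′ below
  go k zero d below | suc w , d′ with () ← ⇓-det d d′
  go k (suc f) d below | suc w , d′ =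
    go (suc k) f (subst (λ t → e [ t ∷ xs ]⇓ 0) (sym (ℕ.+-suc f k)) d) below′
    where
    below′ : ∀ z → z < suc k → ∃[ w ] e [ z ∷ xs ]⇓ suc w
    below′ z z<1+k with ℕ.m<1+n⇒m<n∨m≡n z<1+k
    ... | inj₁ z<k  = below z z<k
    ... | inj₂ refl = w , d′

------------------------------------------------------------------------
-- Computable, c.e. and cohesive sets

Halts : Code 1 → Pred ℕ 0ℓ
Halts e i = ∃[ v ] e [ i ∷ [] ]⇓ v

ComputableSet : Pred ℕ 0ℓ → Set
ComputableSet A = ∃[ e ] ∀ i →
  (i ∈ A × e [ i ∷ [] ]⇓ 1) ⊎ (¬ i ∈ A × e [ i ∷ [] ]⇓ 0)

Finite : Pred ℕ 0ℓ → Set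
Finite A = ∃[ xs ] ∀ {i} → i ∈ A → i List.∈ xs

infix 4 _⊆*_

_⊆*_ : Pred ℕ 0ℓ → Pred ℕ 0ℓ → Set
A ⊆* B = Finite (A ∖ B)

-- The c.e. sets are the sets Halts e.
record Cohesive (C : Pred ℕ 0ℓ) : Set where
  field
    infinite : ¬ Finite C
    cohesive : ∀ e → C ⊆* Halts e ⊎ C ⊆* ∁ (Halts e)

module _ {C : Pred ℕ 0ℓ} where

  ⊆*-map : ∀ {A B : Pred ℕ 0ℓ} → (∀ {i} → A i → B i) → C ⊆* A → C ⊆* B
  ⊆*-map f (xs , h) = xs , λ (c , ¬b) → h (c , ¬b ∘ f)

  ⊆*-zip : ∀ {A B D : Pred ℕ 0ℓ} → (∀ {i} → A i → B i → D i) →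
           C ⊆* A → C ⊆* B → C ⊆* D
  ⊆*-zip {A} {B} {D} f (xs , h) (ys , k) = xs ++ ys , member
    where
    member : ∀ {i} → i ∈ C ∖ D → i List.∈ xs ++ ys
    member {i} (c , ¬d) with i ∈? xs ++ ys
    ... | yes p = p
    ... | no ¬p = ⊥-elim (¬p (∈-++⁺ˡ (h (c , λ a →
                    ¬p (∈-++⁺ʳ xs (k (c , λ b → ¬d (f a b))))))))

  ⊆*-all : ∀ {A : Pred ℕ 0ℓ} → (∀ i → A i) → C ⊆* A
  ⊆*-all f = [] , λ (_ , ¬a) → ⊥-elim (¬a (f _))

------------------------------------------------------------------------
-- Computable fields

infix 4 _≐_

-- Equality of elements of a set of natural numbers.
_≐_ : {D : Pred ℕ 0ℓ} → Rel (∃ D) 0ℓ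
x ≐ y = proj₁ x ≡ proj₁ y

-- A computable structure with domain Dom in the language of rings.  As
-- its equality is that of ℕ, its atomic diagram is computable when its
-- operations are.  Including negation is harmless, since it can be found
-- by search from addition.  The condition isHeytingField, with the
-- negation of equality as its apartness, says that the structure is a
-- field in the ordinary sense.
record ComputableField : Set₁ where
  infix  8 -_
  infixl 7 _*_
  infixl 6 _+_
  field
    Dom            : Pred ℕ 0ℓ
    dom-computable : ComputableSet Dom
    _+_ _*_        : Op₂ (∃ Dom)
    -_             : Op₁ (∃ Dom)
    0# 1#          : ∃ Dom
    isHeytingField : IsHeytingField _≐_ (λ x y → ¬ x ≐ y) _+_ _*_ -_ 0# 1#
    +-computable   : ∃[ e ] ∀ x y →
                     e [ proj₁ x ∷ proj₁ y ∷ [] ]⇓ proj₁ (x + y)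
    *-computable   : ∃[ e ] ∀ x y →
                     e [ proj₁ x ∷ proj₁ y ∷ [] ]⇓ proj₁ (x * y)
    neg-computable : ∃[ e ] ∀ x → e [ proj₁ x ∷ [] ]⇓ proj₁ (- x)

  heytingField : HeytingField 0ℓ 0ℓ 0ℓ
  heytingField = record { isHeytingField = isHeytingField }

  open HeytingField heytingField public using (Carrier; _≈_)

------------------------------------------------------------------------
-- Cohesive powers

-- A representative of an element of the cohesive power: a code for a
-- partial function into D whose domain almost contains C.
record PartialElement (C D : Pred ℕ 0ℓ) : Set where
  field
    code   : Code 1
    into   : ∀ {i v} → code [ i ∷ [] ]⇓ v → v ∈ D
    almost : C ⊆* Halts code

open PartialElement

-- The elements of the cohesive power are the representatives, with the
-- equality φ ≈ ψ in place of the passage to classes.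
module CohesivePower (A : ComputableField) {C : Pred ℕ 0ℓ} (coh : Cohesive C) where

  private
    module A = ComputableField A
    module R = HeytingField A.heytingField
  open Cohesive coh

  Element : Set
  Element = PartialElement C A.Dom

  Agree : Element → Element → Pred ℕ 0ℓ
  Agree φ ψ i = ∃[ v ] code φ [ i ∷ [] ]⇓ v × code ψ [ i ∷ [] ]⇓ v

  infix 4 _≈_ _≉_

  _≈_ _≉_ : Rel Element 0ℓ
  φ ≈ ψ = C ⊆* Agree φ ψ
  φ ≉ ψ = ¬ φ ≈ ψ

  infix 4 _at_↦_

  record _at_↦_ (φ : Element) (i : ℕ) (x : A.Carrier) : Set where
    constructor run
    field value : code φ [ i ∷ [] ]⇓ proj₁ x

  Defined : Element → Pred ℕ 0ℓ
  Defined φ i = ∃[ x ] φ at i ↦ x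

  defined : ∀ φ → C ⊆* Defined φ
  defined φ = ⊆*-map (λ (v , d) → (v , into φ d) , run d) (almost φ)

  agree : ∀ φ ψ {i x y} → φ at i ↦ x → ψ at i ↦ y → x ≐ y → Agree φ ψ i
  agree φ ψ {x = x} (run d) (run e) x≡y =
    proj₁ x , d , subst (code ψ [ _ ]⇓_) (sym x≡y) e

  constant : A.Carrier → Element
  constant a = record
    { code   = constᶜ (proj₁ a)
    ; into   = λ d → subst A.Dom (⇓-det (constᶜ-⇓ (proj₁ a)) d) (proj₂ a)
    ; almost = ⊆*-all (λ i → proj₁ a , constᶜ-⇓ (proj₁ a))
    }

  lift₁ : (f : Op₁ A.Carrier) →
          ∃[ e ] (∀ x → e [ proj₁ x ∷ [] ]⇓ proj₁ (f x)) → Op₁ Element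
  lift₁ f (e , h) φ = record
    { code   = comp e (code φ ∷ [])
    ; into   = λ { (⇓comp (d ∷ []) d′) →
                 subst A.Dom (⇓-det (h (_ , into φ d)) d′) (proj₂ (f _)) }
    ; almost = ⊆*-map (λ (x , run d) → _ , ⇓comp (d ∷ []) (h x)) (defined φ)
    }

  lift₂ : (f : Op₂ A.Carrier) →
          ∃[ e ] (∀ x y → e [ proj₁ x ∷ proj₁ y ∷ [] ]⇓ proj₁ (f x y)) →
          Op₂ Element
  lift₂ f (e , h) φ ψ = record
    { code   = comp e (code φ ∷ code ψ ∷ [])
    ; into   = λ { (⇓comp (d ∷ d′ ∷ []) d″) →
                 subst A.Dom (⇓-det (h (_ , into φ d) (_ , into ψ d′)) d″)
                   (proj₂ (f _ _)) }
    ; almost = ⊆*-zip (λ (x , run d) (y , run d′) → _ , ⇓comp (d ∷ d′ ∷ []) (h x y))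
                 (defined φ) (defined ψ)
    }

  infix  8 -_
  infixl 7 _*_
  infixl 6 _+_

  _+_ _*_ : Op₂ Element
  _+_ = lift₂ A._+_ A.+-computable
  _*_ = lift₂ A._*_ A.*-computable

  -_ : Op₁ Element
  -_ = lift₁ A.-_ A.neg-computable

  0# 1# : Element
  0# = constant A.0#
  1# = constant A.1#

  module _ {i : ℕ} where

    +-at : ∀ φ ψ {x y} → φ at i ↦ x → ψ at i ↦ y → (φ + ψ) at i ↦ x A.+ y
    +-at φ ψ {x} {y} (run d) (run e) =
      run (⇓comp (d ∷ e ∷ []) (proj₂ A.+-computable x y))

    *-at : ∀ φ ψ {x y} → φ at i ↦ x → ψ at i ↦ y → (φ * ψ) at i ↦ x A.* y
    *-at φ ψ {x} {y} (run d) (run e) =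
      run (⇓comp (d ∷ e ∷ []) (proj₂ A.*-computable x y))

    neg-at : ∀ φ {x} → φ at i ↦ x → (- φ) at i ↦ A.- x
    neg-at φ {x} (run d) = run (⇓comp (d ∷ []) (proj₂ A.neg-computable x))

    0-at : 0# at i ↦ A.0#
    0-at = run (constᶜ-⇓ _)

    1-at : 1# at i ↦ A.1#
    1-at = run (constᶜ-⇓ _)

  ≈-refl : ∀ {φ} → φ ≈ φ
  ≈-refl {φ} = ⊆*-map (λ (v , d) → v , d , d) (almost φ)

  ≈-sym : ∀ {φ ψ} → φ ≈ ψ → ψ ≈ φ
  ≈-sym = ⊆*-map (λ (v , d , e) → v , e , d)

  ≈-trans : ∀ {φ ψ χ} → φ ≈ ψ → ψ ≈ χ → φ ≈ χ
  ≈-trans {χ = χ} = ⊆*-zip (λ { (v , d , e) (w , e′ , f) →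
    v , d , subst (code χ [ _ ]⇓_) (⇓-det e′ e) f })

  law₁ : ∀ φ {σ τ} → (∀ {i x} → φ at i ↦ x → Agree σ τ i) → σ ≈ τ
  law₁ φ h = ⊆*-map (λ (_ , d) → h d) (defined φ)

  law₂ : ∀ φ ψ {σ τ} →
         (∀ {i x y} → φ at i ↦ x → ψ at i ↦ y → Agree σ τ i) → σ ≈ τ
  law₂ φ ψ h = ⊆*-zip (λ (_ , d) (_ , e) → h d e) (defined φ) (defined ψ)

  law₃ : ∀ φ ψ χ {σ τ} →
         (∀ {i x y z} → φ at i ↦ x → ψ at i ↦ y → χ at i ↦ z → Agree σ τ i) →
         σ ≈ τ
  law₃ φ ψ χ h = ⊆*-zip (λ (_ , _ , d , e) (_ , f) → h d e f)
    (⊆*-zip (λ (x , d) (y , e) → x , y , d , e) (defined φ) (defined ψ))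
    (defined χ)

  agree₂ : ∀ {f} (c : ∃[ e ] (∀ x y → e [ proj₁ x ∷ proj₁ y ∷ [] ]⇓ proj₁ (f x y)))
           {φ φ′ ψ ψ′} → φ ≈ φ′ → ψ ≈ ψ′ → lift₂ f c φ ψ ≈ lift₂ f c φ′ ψ′
  agree₂ (_ , h) {φ} {ψ = ψ} = ⊆*-zip (λ (v , d , d′) (w , e , e′) →
    _ , ⇓comp (d ∷ e ∷ []) (h (v , into φ d) (w , into ψ e))
      , ⇓comp (d′ ∷ e′ ∷ []) (h (v , into φ d) (w , into ψ e)))

  isCommutativeRing : IsCommutativeRing _≈_ _+_ _*_ -_ 0# 1#
  isCommutativeRing = record
    { isRing = record
      { +-isAbelianGroup = record
        { isGroup = record
          { isMonoid = record
            { isSemigroup = record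
              { isMagma = record
                { isEquivalence = isEquivalence
                ; ∙-cong = λ {φ} {φ′} {ψ} {ψ′} →
                    agree₂ {A._+_} A.+-computable {φ} {φ′} {ψ} {ψ′}
                }
              ; assoc = λ φ ψ χ → law₃ φ ψ χ {(φ + ψ) + χ} {φ + (ψ + χ)} λ d e f →
                  agree ((φ + ψ) + χ) (φ + (ψ + χ))
                    (+-at (φ + ψ) χ (+-at φ ψ d e) f)
                    (+-at φ (ψ + χ) d (+-at ψ χ e f)) (R.+-assoc _ _ _)
              }
            ; identity =
                (λ φ → law₁ φ {0# + φ} {φ} λ d →
                  agree (0# + φ) φ (+-at 0# φ 0-at d) d (R.+-identityˡ _))
              , (λ φ → law₁ φ {φ + 0#} {φ} λ d →
                  agree (φ + 0#) φ (+-at φ 0# d 0-at) d (R.+-identityʳ _))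
            }
          ; inverse =
              (λ φ → law₁ φ {(- φ) + φ} {0#} λ d →
                agree ((- φ) + φ) 0# (+-at (- φ) φ (neg-at φ d) d) 0-at
                  (R.-‿inverseˡ _))
            , (λ φ → law₁ φ {φ + (- φ)} {0#} λ d →
                agree (φ + (- φ)) 0# (+-at φ (- φ) d (neg-at φ d)) 0-at
                  (R.-‿inverseʳ _))
          ; ⁻¹-cong = λ {φ} → ⊆*-map λ (v , d , d′) →
              _ , ⇓comp (d ∷ []) (proj₂ A.neg-computable (v , into φ d))
                , ⇓comp (d′ ∷ []) (proj₂ A.neg-computable (v , into φ d))
          }
        ; comm = λ φ ψ → law₂ φ ψ {φ + ψ} {ψ + φ} λ d e →
            agree (φ + ψ) (ψ + φ) (+-at φ ψ d e) (+-at ψ φ e d) (R.+-comm _ _)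
        }
      ; *-cong = λ {φ} {φ′} {ψ} {ψ′} → agree₂ {A._*_} A.*-computable {φ} {φ′} {ψ} {ψ′}
      ; *-assoc = λ φ ψ χ → law₃ φ ψ χ {(φ * ψ) * χ} {φ * (ψ * χ)} λ d e f →
          agree ((φ * ψ) * χ) (φ * (ψ * χ))
            (*-at (φ * ψ) χ (*-at φ ψ d e) f)
            (*-at φ (ψ * χ) d (*-at ψ χ e f)) (R.*-assoc _ _ _)
      ; *-identity =
          (λ φ → law₁ φ {1# * φ} {φ} λ d →
            agree (1# * φ) φ (*-at 1# φ 1-at d) d (R.*-identityˡ _))
        , (λ φ → law₁ φ {φ * 1#} {φ} λ d →
            agree (φ * 1#) φ (*-at φ 1# d 1-at) d (R.*-identityʳ _))
      ; distrib =
          (λ φ ψ χ → law₃ φ ψ χ {φ * (ψ + χ)} {φ * ψ + φ * χ} λ d e f →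
            agree (φ * (ψ + χ)) (φ * ψ + φ * χ)
              (*-at φ (ψ + χ) d (+-at ψ χ e f))
              (+-at (φ * ψ) (φ * χ) (*-at φ ψ d e) (*-at φ χ d f))
              (R.distribˡ _ _ _))
        , (λ φ ψ χ → law₃ φ ψ χ {(ψ + χ) * φ} {ψ * φ + χ * φ} λ d e f →
            agree ((ψ + χ) * φ) (ψ * φ + χ * φ)
              (*-at (ψ + χ) φ (+-at ψ χ e f) d)
              (+-at (ψ * φ) (χ * φ) (*-at ψ φ e d) (*-at χ φ f d))
              (R.distribʳ _ _ _))
      }
    ; *-comm = λ φ ψ → law₂ φ ψ {φ * ψ} {ψ * φ} λ d e →
        agree (φ * ψ) (ψ * φ) (*-at φ ψ d e) (*-at ψ φ e d) (R.*-comm _ _)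
    }
    where
    isEquivalence : IsEquivalence _≈_
    isEquivalence = record
      { refl  = λ {φ} → ≈-refl {φ}
      ; sym   = λ {φ} {ψ} → ≈-sym {φ} {ψ}
      ; trans = λ {φ} {ψ} {χ} → ≈-trans {φ} {ψ} {χ}
      }

  -- The inverse of δ is found by searching through the domain of A.
  module _ (δ : Element) where

    private
      candidateᶜ : Code 2
      candidateᶜ = comp (rec (constᶜ (proj₁ A.0#)) (proj 2F))
        (comp (proj₁ A.dom-computable) (proj 0F ∷ []) ∷ proj 0F ∷ [])

      candidate : ∀ y {i} → ∃[ c ]
        (candidateᶜ [ y ∷ i ∷ [] ]⇓ proj₁ {B = A.Dom} c × (y ∈ A.Dom → proj₁ c ≡ y))
      candidate y with proj₂ A.dom-computable y
      ... | inj₁ (p , d) = (y , p)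
        , ⇓comp (⇓comp (⇓proj 0F ∷ []) d ∷ ⇓proj 0F ∷ [])
            (⇓recS (⇓rec0 (constᶜ-⇓ _)) (⇓proj 2F))
        , λ _ → refl
      ... | inj₂ (¬p , d) = A.0#
        , ⇓comp (⇓comp (⇓proj 0F ∷ []) d ∷ ⇓proj 0F ∷ []) (⇓rec0 (constᶜ-⇓ _))
        , λ p → ⊥-elim (¬p p)

      testᶜ : Code 2
      testᶜ = comp distᶜ
        (comp (proj₁ A.*-computable) (candidateᶜ ∷ comp (code δ) (proj 1F ∷ []) ∷ [])
         ∷ constᶜ (proj₁ A.1#) ∷ [])

      test : ∀ y {i x w} → δ at i ↦ x →
             distᶜ [ proj₁ (proj₁ (candidate y {i}) A.* x) ∷ proj₁ A.1# ∷ [] ]⇓ w →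
             testᶜ [ y ∷ i ∷ [] ]⇓ w
      test y {i} {x} (run d) e = ⇓comp
        (⇓comp (proj₁ (proj₂ (candidate y)) ∷ ⇓comp (⇓proj 1F ∷ []) d ∷ [])
           (proj₂ A.*-computable (proj₁ (candidate y {i})) x)
         ∷ constᶜ-⇓ _ ∷ []) e

      inverseᶜ : Code 1
      inverseᶜ = comp candidateᶜ (μ testᶜ ∷ proj 0F ∷ [])

      inverse-at : ∀ {i x u} → δ at i ↦ x → u A.* x ≐ A.1# →
                   ∃[ c ] inverseᶜ [ i ∷ [] ]⇓ proj₁ {B = A.Dom} c × c A.* x ≐ A.1#
      inverse-at {i} {x} {u} d ux≡1
        with μ-search (λ y → _ , test y d (distᶜ-⇓ (value y) one))
               (test (proj₁ u) d (subst (λ t → distᶜ [ t ∷ one ∷ [] ]⇓ 0)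
                 (sym value≡one) (distᶜ-refl one)))
        where
        one : ℕ
        one = proj₁ A.1#

        value : ℕ → ℕ
        value y = proj₁ (proj₁ (candidate y {i}) A.* x)

        value≡one : value (proj₁ u) ≡ one
        value≡one = trans
          (R.*-cong {x = proj₁ (candidate (proj₁ u) {i})} {y = u} {u = x} {v = x}
            (proj₂ (proj₂ (candidate (proj₁ u) {i})) (proj₂ u)) refl) ux≡1
      ... | y , e@(⇓μ e′ _) = proj₁ (candidate y {i})
          , ⇓comp (e ∷ ⇓proj 0F ∷ []) (proj₁ (proj₂ (candidate y {i})))
          , distᶜ-≡ (subst (distᶜ [ value ∷ one ∷ [] ]⇓_)
              (⇓-det (test y d (distᶜ-⇓ value one)) e′) (distᶜ-⇓ value one))
        where
        one value : ℕ
        one   = proj₁ A.1#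
        value = proj₁ (proj₁ (candidate y {i}) A.* x)

    inverse : (C ⊆* λ i → ∃[ x ] ∃[ u ] (δ at i ↦ x) × (u A.* x ≐ A.1#)) →
              ∃[ φ ] φ * δ ≈ 1#
    inverse inv = φ , ⊆*-map (λ (x , u , d , e) → step x u d e) inv
      where
      φ : Element
      φ = record
        { code   = inverseᶜ
        ; into   = λ { (⇓comp (_∷_ {v = y} _ (_ ∷ [])) d) →
                     subst A.Dom (⇓-det (proj₁ (proj₂ (candidate y))) d)
                       (proj₂ (proj₁ (candidate y))) }
        ; almost = ⊆*-map (λ (x , u , d , e) →
                     let c , d′ , _ = inverse-at {u = u} d e in proj₁ c , d′) inv
        }

      step : ∀ {i} x u → δ at i ↦ x → u A.* x ≐ A.1# → Agree (φ * δ) 1# i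
      step x u d e with inverse-at {u = u} d e
      ... | c , d′ , eq = agree (φ * δ) 1# (*-at φ δ {x = c} (run d′) d) 1-at eq

  equalizerᶜ : Element → Element → Code 1
  equalizerᶜ φ ψ = μ (comp distᶜ
    (comp (code φ) (proj 1F ∷ []) ∷ comp (code ψ) (proj 1F ∷ []) ∷ []))

  equalizer⇒agree : ∀ {φ ψ i} → Halts (equalizerᶜ φ ψ) i → Agree φ ψ i
  equalizer⇒agree {ψ = ψ} (_ , ⇓μ (⇓comp
    (⇓comp (⇓proj _ ∷ []) d ∷ ⇓comp (⇓proj _ ∷ []) e ∷ []) f) _) =
    _ , d , subst (code ψ [ _ ]⇓_) (sym (distᶜ-≡ f)) e

  agree⇒equalizer : ∀ {φ ψ i} → Agree φ ψ i → Halts (equalizerᶜ φ ψ) i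
  agree⇒equalizer (v , d , e) = 0 , ⇓μ
    (⇓comp (⇓comp (⇓proj 1F ∷ []) d ∷ ⇓comp (⇓proj 1F ∷ []) e ∷ []) (distᶜ-refl v))
    (λ _ ())

  ≈-dichotomy : ∀ φ ψ → φ ≈ ψ ⊎ C ⊆* ∁ (Agree φ ψ)
  ≈-dichotomy φ ψ with cohesive (equalizerᶜ φ ψ)
  ... | inj₁ h = inj₁ (⊆*-map (equalizer⇒agree {φ} {ψ}) h)
  ... | inj₂ h = inj₂ (⊆*-map (_∘ agree⇒equalizer {φ} {ψ}) h)

  ≈-contradiction : ∀ {φ ψ} → φ ≈ ψ → C ⊆* ∁ (Agree φ ψ) → ⊥
  ≈-contradiction p q =
    let xs , h = ⊆*-zip {D = λ _ → ⊥} (λ a ¬a → ¬a a) p q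
    in infinite (xs , λ c → h (c , λ ()))

  ≉⇒ : ∀ {φ ψ} → φ ≉ ψ → C ⊆* ∁ (Agree φ ψ)
  ≉⇒ {φ} {ψ} φ≉ψ with ≈-dichotomy φ ψ
  ... | inj₁ p = ⊥-elim (φ≉ψ p)
  ... | inj₂ q = q

  private module P = IsCommutativeRing isCommutativeRing

  isHeytingField : IsHeytingField _≈_ _≉_ _+_ _*_ -_ 0# 1#
  isHeytingField = record
    { isHeytingCommutativeRing = record
      { isCommutativeRing   = isCommutativeRing
      ; isApartnessRelation = record
        { irrefl  = λ p ¬p → ¬p p
        ; sym     = λ {φ} {ψ} ¬p p → ¬p (≈-sym {ψ} {φ} p)
        ; cotrans = λ {φ} {ψ} → cotrans {φ} {ψ}
        }
      ; #⇒invertible = λ {φ} {ψ} → invertible φ ψ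
      ; invertible⇒# = λ {φ} {ψ} → apart φ ψ
      }
    ; tight = λ φ ψ → stable φ ψ , λ p ¬p → ¬p p
    }
    where
    cotrans : ∀ {φ ψ} → φ ≉ ψ → ∀ χ → φ ≉ χ ⊎ χ ≉ ψ
    cotrans {φ} {ψ} φ≉ψ χ with ≈-dichotomy φ χ
    ... | inj₁ p = inj₂ λ q → φ≉ψ (≈-trans {φ} {χ} {ψ} p q)
    ... | inj₂ q = inj₁ λ p → ≈-contradiction {φ} {χ} p q

    stable : ∀ φ ψ → ¬ φ ≉ ψ → φ ≈ ψ
    stable φ ψ ¬¬p with ≈-dichotomy φ ψ
    ... | inj₁ p = p
    ... | inj₂ q = ⊥-elim (¬¬p λ p → ≈-contradiction {φ} {ψ} p q)

    invertible : ∀ φ ψ → φ ≉ ψ → Invertible _≈_ 1# _*_ (φ + (- ψ))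
    invertible φ ψ φ≉ψ =
      let χ , e = inverse δ (⊆*-zip {A = ∁ (Agree φ ψ)} (λ ¬a (x , y , d , e) → pointwise ¬a x y d e)
                    (≉⇒ {φ} {ψ} φ≉ψ)
                    (⊆*-zip (λ (x , d) (y , e) → x , y , d , e) (defined φ) (defined ψ)))
      in χ , e , ≈-trans {δ * χ} {χ * δ} {1#} (P.*-comm δ χ) e
      where
      δ : Element
      δ = φ + (- ψ)

      pointwise : ∀ {i} → ¬ Agree φ ψ i → ∀ x y → φ at i ↦ x → ψ at i ↦ y →
                  ∃[ z ] ∃[ u ] (δ at i ↦ z) × (u A.* z ≐ A.1#)
      pointwise ¬a x y d e =
        let u , p , _ = R.#⇒invertible {x} {y} (λ x≡y → ¬a (agree φ ψ d e x≡y))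
        in x A.+ (A.- y) , u , +-at φ (- ψ) d (neg-at ψ e) , p

    apart : ∀ φ ψ → Invertible _≈_ 1# _*_ (φ + (- ψ)) → φ ≉ ψ
    apart φ ψ (χ , e , _) φ≈ψ =
      let xs , h = ⊆*-zip {D = λ _ → ⊥} (λ (p , q) (r , s) → absurd p q r s)
                     (⊆*-zip _,_ φ≈ψ e) (⊆*-zip _,_ (defined ψ) (defined χ))
      in infinite (xs , λ c → h (c , λ ()))
      where
      absurd : ∀ {i} → Agree φ ψ i → Agree (χ * (φ + (- ψ))) 1# i →
               Defined ψ i → Defined χ i → ⊥
      absurd (v , d , d′) (w , e , e′) (y , f@(run f′)) (u , g) =
        R.invertible⇒# {x} {y} (u , ux≡1 , trans (R.*-comm (x A.+ (A.- y)) u) ux≡1)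
          (⇓-det d′ f′)
        where
        x : A.Carrier
        x = v , into φ d

        ux≡1 : u A.* (x A.+ (A.- y)) ≐ A.1#
        ux≡1 = trans
          (⇓-det (_at_↦_.value (*-at χ (φ + (- ψ)) g (+-at φ (- ψ) (run d) (neg-at ψ f)))) e)
          (⇓-det e′ (constᶜ-⇓ _))

  heytingField : HeytingField 0ℓ 0ℓ 0ℓ
  heytingField = record { isHeytingField = isHeytingField }

------------------------------------------------------------------------
-- Field extensions

ringOf : HeytingField 0ℓ 0ℓ 0ℓ → RawRing 0ℓ 0ℓ
ringOf F = CommutativeRing.rawRing
  (HeytingCommutativeRing.commutativeRing (HeytingField.heytingCommutativeRing F))

record FieldExtension : Set₁ where
  field
    base top           : HeytingField 0ℓ 0ℓ 0ℓ
    ι                  : HeytingField.Carrier base → HeytingField.Carrier top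
    isRingHomomorphism : RingMorphisms.IsRingHomomorphism (ringOf base) (ringOf top) ι

record ComputableFieldExtension : Set₁ where
  field
    K F                  : ComputableField
    Ψ                    : ComputableField.Carrier F → ComputableField.Carrier K
    Ψ-isRingHomomorphism : RingMorphisms.IsRingHomomorphism
      (ringOf (ComputableField.heytingField F))
      (ringOf (ComputableField.heytingField K)) Ψ
    Ψ-computable         : ∃[ e ] ∀ a → e [ proj₁ a ∷ [] ]⇓ proj₁ (Ψ a)

  extension : FieldExtension
  extension = record
    { base               = ComputableField.heytingField F
    ; top                = ComputableField.heytingField K
    ; ι                  = Ψ
    ; isRingHomomorphism = Ψ-isRingHomomorphism
    }

module _ (E : ComputableFieldExtension) {C : Pred ℕ 0ℓ} (coh : Cohesive C) where

  open ComputableFieldExtension E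

  private
    module F  = ComputableField F
    module K  = ComputableField K
    module ΠF = CohesivePower F coh
    module ΠK = CohesivePower K coh
    module Ψ  = RingMorphisms.IsRingHomomorphism Ψ-isRingHomomorphism

  compose : ΠF.Element → ΠK.Element
  compose α = record
    { code   = comp (proj₁ Ψ-computable) (code α ∷ [])
    ; into   = λ { (⇓comp (d ∷ []) d′) →
                 subst K.Dom (⇓-det (proj₂ Ψ-computable (_ , into α d)) d′)
                   (proj₂ (Ψ _)) }
    ; almost = ⊆*-map (λ (x , ΠF.run d) → _ , ⇓comp (d ∷ []) (proj₂ Ψ-computable x))
                 (ΠF.defined α)
    }

  compose-at : ∀ α {i x} → α ΠF.at i ↦ x → compose α ΠK.at i ↦ Ψ x
  compose-at α {x = x} (ΠF.run d) = ΠK.run (⇓comp (d ∷ []) (proj₂ Ψ-computable x))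

  -- The extension of cohesive powers induced by α ↦ Ψ ∘ α.
  cohesivePower : FieldExtension
  cohesivePower = record
    { base = ΠF.heytingField
    ; top  = ΠK.heytingField
    ; ι    = compose
    ; isRingHomomorphism = record
      { isSemiringHomomorphism = record
        { isNearSemiringHomomorphism = record
          { +-isMonoidHomomorphism = record
            { isMagmaHomomorphism = record
              { isRelHomomorphism = record
                { cong = λ {α} → ⊆*-map λ (v , d , e) → let x = v , into α d in
                    _ , ⇓comp (d ∷ []) (proj₂ Ψ-computable x)
                      , ⇓comp (e ∷ []) (proj₂ Ψ-computable x)
                }
              ; homo = λ α β → ⊆*-zip (λ (_ , d) (_ , e) →
                  ΠK.agree (compose (α ΠF.+ β)) (compose α ΠK.+ compose β)
                    (compose-at (α ΠF.+ β) (ΠF.+-at α β d e))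
                    (ΠK.+-at (compose α) (compose β) (compose-at α d) (compose-at β e))
                    (Ψ.+-homo _ _)) (ΠF.defined α) (ΠF.defined β)
              }
            ; ε-homo = ⊆*-all λ _ → ΠK.agree (compose ΠF.0#) ΠK.0#
                (compose-at ΠF.0# ΠF.0-at) ΠK.0-at Ψ.0#-homo
            }
          ; *-homo = λ α β → ⊆*-zip (λ (_ , d) (_ , e) →
              ΠK.agree (compose (α ΠF.* β)) (compose α ΠK.* compose β)
                (compose-at (α ΠF.* β) (ΠF.*-at α β d e))
                (ΠK.*-at (compose α) (compose β) (compose-at α d) (compose-at β e))
                (Ψ.*-homo _ _)) (ΠF.defined α) (ΠF.defined β)
          }
        ; 1#-homo = ⊆*-all λ _ → ΠK.agree (compose ΠF.1#) ΠK.1#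
            (compose-at ΠF.1# ΠF.1-at) ΠK.1-at Ψ.1#-homo
        }
      ; -‿homo = λ α → ⊆*-map (λ (_ , d) →
          ΠK.agree (compose (ΠF.- α)) (ΠK.- compose α)
            (compose-at (ΠF.- α) (ΠF.neg-at α d))
            (ΠK.neg-at (compose α) (compose-at α d)) (Ψ.-‿homo _)) (ΠF.defined α)
      }
    }

------------------------------------------------------------------------
-- Polynomials, degrees and transcendence over a field extension

module Extension (E : FieldExtension) where

  open FieldExtension E

  private
    module F = HeytingField base
    module K = HeytingField top

  -- Polynomials over F in n variables: F[X₁,…,Xₙ₊₁] is F[X₂,…,Xₙ₊₁][X₁],
  -- and a polynomial in one variable is its list of coefficients in
  -- ascending order, possibly ending in zeros.
  Poly : ℕ → Set
  Poly zero    = F.Carrier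
  Poly (suc n) = List (Poly n)

  IsZero : ∀ n → Poly n → Set
  IsZero zero    a = a F.≈ F.0#
  IsZero (suc n) p = All (IsZero n) p

  eval : ∀ n → Poly n → Vec K.Carrier n → K.Carrier
  eval zero    a []       = ι a
  eval (suc n) p (x ∷ xs) = foldr (λ c v → eval n c xs K.+ x K.* v) K.0# p

  coeff : Poly 1 → ℕ → F.Carrier
  coeff []      _       = F.0#
  coeff (a ∷ p) zero    = a
  coeff (a ∷ p) (suc k) = coeff p k

  HasDegree : Poly 1 → ℕ → Set
  HasDegree p d = ¬ coeff p d F.≈ F.0# × (∀ k → d < k → coeff p k F.≈ F.0#)

  Monic : Poly 1 → Set
  Monic p = ∃[ d ] HasDegree p d × coeff p d F.≈ F.1#

  Root : Poly 1 → K.Carrier → Set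
  Root p a = eval 1 p (a ∷ []) K.≈ K.0#

  -- The minimal polynomial of a is the monic polynomial of least degree
  -- having a as a root.
  IsMinimalPolynomial : K.Carrier → Poly 1 → Set
  IsMinimalPolynomial a p = Monic p × Root p a ×
    (∀ q {d e} → HasDegree p d → HasDegree q e → Root q a → d ≤ e)

  -- deg is the map sending an element of K, which is thus required to be
  -- algebraic over F, to the degree of its minimal polynomial.
  IsDegreeMap : (K.Carrier → ℕ) → Set
  IsDegreeMap deg = ∀ a → ∃[ p ] IsMinimalPolynomial a p × HasDegree p (deg a)

  IsAlgebraic : K.Carrier → Set
  IsAlgebraic a = ∃[ p ] ¬ IsZero 1 p × Root p a

  IsTranscendental : Set
  IsTranscendental = ∃[ a ] ¬ IsAlgebraic a

  AlgebraicallyIndependent : ∀ n → Vec K.Carrier n → Set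
  AlgebraicallyIndependent n xs = ∀ p → eval n p xs K.≈ K.0# → IsZero n p

  -- The transcendence degree is the largest cardinality of an
  -- algebraically independent set.  It is infinite when some sequence is
  -- algebraically independent; as every finite part of a sequence lies in
  -- an initial segment, initial segments suffice.
  InfiniteTranscendenceDegree : Set
  InfiniteTranscendenceDegree = ∃[ x ] ∀ n →
    AlgebraicallyIndependent n (tabulate (x ∘ toℕ))

{-# OPTIONS --safe #-}

-- Choose α_i with deg α_i ≥ i^(i+1) by unbounded search and let x_j be the
-- class of i ↦ α_i^(i^(i∸j)).  A polynomial p over the cohesive power of F
-- becomes, at almost every i ∈ C, a polynomial p_i over F in n ≤ i
-- variables with at most i coefficients in each of them.  For such p_i the
-- exponents i^(i∸j) make Kronecker's substitution injective on monomials,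
-- so p_i(x_0(i), …, x_{n-1}(i)) is a polynomial in α_i with the same
-- coefficients and of degree below deg α_i.  If it vanishes then so do all
-- the coefficients of p_i.

module Submission where

open import Defs
open import Level using (0ℓ)
open import Algebra.Bundles using (CommutativeRing)
open import Algebra.Apartness.Bundles using (HeytingField; HeytingCommutativeRing)
open import Algebra.Morphism.Structures using (module RingMorphisms)
import Algebra.Properties.Semiring.Exp as Exp
open import Data.Nat.Base
  using (ℕ; zero; suc; _∸_; _≤_; _<_; z≤n; s≤s; z<s; s<s; s<s⁻¹; s≤s⁻¹; >-nonZero)
import Data.Nat as ℕ
import Data.Nat.Properties as ℕ
open import Data.Fin.Base using (toℕ)
open import Data.Fin.Patterns using (0F; 1F; 2F)
open import Data.Vec.Base using (Vec; []; _∷_; map; tabulate)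
open import Data.Vec.Properties using (tabulate-∘)
import Data.Vec.Relation.Binary.Pointwise.Inductive as Vec
open import Data.List.Base using ([]; _∷_; length; upTo)
open import Data.List.Membership.Propositional.Properties using (∈-upTo⁺)
open import Data.List.Relation.Unary.All using (All; []; _∷_)
open import Data.List.Relation.Binary.Pointwise using (Pointwise; []; _∷_; Pointwise-length)
open import Data.Product.Base using (∃-syntax; _×_; _,_; proj₁; proj₂)
open import Data.Sum.Base using (_⊎_; inj₁; inj₂)
open import Data.Unit.Base using (⊤; tt)
open import Data.Empty using (⊥-elim)
open import Function.Base using (_∘_)
open import Relation.Nullary using (yes; no)
open import Relation.Unary using (Pred; _∈_)
open import Relation.Binary.Definitions using (Decidable)
open import Relation.Binary.PropositionalEquality
  using (_≡_; refl; sym; trans; cong; subst)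

-- Kronecker substitution

-- The exponents ws substituted for the variables decrease so fast that
-- polynomials with at most D coefficients in each variable become
-- polynomials with at most M coefficients.
data Steep (D : ℕ) : ∀ {n} → Vec ℕ n → ℕ → Set where
  []  : ∀ {M} → 1 ≤ M → Steep D [] M
  _∷_ : ∀ {n M w} {ws : Vec ℕ n} → D ℕ.* w ≤ M → Steep D ws w → Steep D (w ∷ ws) M

steep-mono : ∀ {D n M M′} {ws : Vec ℕ n} → Steep D ws M → M ≤ M′ → Steep D ws M′
steep-mono ([] 1≤M)    M≤M′ = [] (ℕ.≤-trans 1≤M M≤M′)
steep-mono (Dw≤M ∷ st) M≤M′ = ℕ.≤-trans Dw≤M M≤M′ ∷ st

steep-tabulate : ∀ {D} n (v : ℕ → ℕ) → (∀ k → k < n → D ℕ.* v (suc k) ≤ v k) → 1 ≤ v n →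
                 Steep D (tabulate {n = n} (v ∘ suc ∘ toℕ)) (v 0)
steep-tabulate zero    v step pos = [] pos
steep-tabulate (suc n) v step pos =
  step 0 z<s ∷ steep-tabulate n (v ∘ suc) (λ k k<n → step (suc k) (s<s k<n)) pos

module Kronecker (E : FieldExtension) where

  open FieldExtension E
  open Extension E

  private
    module F = HeytingField base
    module K where
      open CommutativeRing (HeytingCommutativeRing.commutativeRing
        (HeytingField.heytingCommutativeRing top)) public
      open Exp semiring public
    module ι = RingMorphisms.IsRingHomomorphism isRingHomomorphism

  open K public using (_^_)
  open import Relation.Binary.Reasoning.Setoid K.setoid

  -- List lengths are bounded instead of degrees: when a polynomial over the cohesive power is
  -- evaluated at an index, its lengths stay fixed while its leading coefficients may vanish.
  Width : ℕ → ∀ n → Poly n → Set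
  Width D zero    _ = ⊤
  Width D (suc n) p = length p ≤ D × All (Width D n) p

  -- The coefficient list of l + X^w r, for l with at most w coefficients.
  glue : ℕ → Poly 1 → Poly 1 → Poly 1
  glue zero    l       r = r
  glue (suc w) []      r = F.0# ∷ glue w [] r
  glue (suc w) (a ∷ l) r = a ∷ glue w l r

  length-glue : ∀ w l r → length (glue w l r) ≡ w ℕ.+ length r
  length-glue zero    l       r = refl
  length-glue (suc w) []      r = cong suc (length-glue w [] r)
  length-glue (suc w) (a ∷ l) r = cong suc (length-glue w l r)

  -- Since `l` fits into its `w` slots, `glue` only pads it with zeros; a longer `l` would be
  -- truncated.
  glue-isZero : ∀ w l r → length l ≤ w → IsZero 1 (glue w l r) → IsZero 1 l × IsZero 1 r
  glue-isZero zero    []      r _   z       = [] , z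
  glue-isZero (suc w) []      r _   (_ ∷ z) = glue-isZero w [] r z≤n z
  glue-isZero (suc w) (a ∷ l) r l≤w (a≈0 ∷ z) =
    let z₁ , z₂ = glue-isZero w l r (s≤s⁻¹ l≤w) z in a≈0 ∷ z₁ , z₂

  module _ (α : K.Carrier) where

    private
      ev : Poly 1 → K.Carrier
      ev p = eval 1 p (α ∷ [])

    eval-glue : ∀ w l r → length l ≤ w → ev (glue w l r) K.≈ ev l K.+ α ^ w K.* ev r
    eval-glue zero [] r _ = begin
      ev r                     ≈⟨ K.*-identityˡ _ ⟨
      K.1# K.* ev r            ≈⟨ K.+-identityˡ _ ⟨
      K.0# K.+ K.1# K.* ev r   ∎
    eval-glue (suc w) [] r _ = begin
      ι F.0# K.+ α K.* ev (glue w [] r)           ≈⟨ K.+-cong ι.0#-homo (K.*-congˡ (eval-glue w [] r z≤n)) ⟩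
      K.0# K.+ α K.* (K.0# K.+ α ^ w K.* ev r)    ≈⟨ K.+-congˡ (K.*-congˡ (K.+-identityˡ _)) ⟩
      K.0# K.+ α K.* (α ^ w K.* ev r)             ≈⟨ K.+-congˡ (K.*-assoc _ _ _) ⟨
      K.0# K.+ α ^ suc w K.* ev r                 ∎
    eval-glue (suc w) (a ∷ l) r l≤w = begin
      ι a K.+ α K.* ev (glue w l r)                     ≈⟨ K.+-congˡ (K.*-congˡ (eval-glue w l r (s≤s⁻¹ l≤w))) ⟩
      ι a K.+ α K.* (ev l K.+ α ^ w K.* ev r)           ≈⟨ K.+-congˡ (K.distribˡ _ _ _) ⟩
      ι a K.+ (α K.* ev l K.+ α K.* (α ^ w K.* ev r))   ≈⟨ K.+-assoc _ _ _ ⟨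
      ι a K.+ α K.* ev l K.+ α K.* (α ^ w K.* ev r)     ≈⟨ K.+-congˡ (K.*-assoc _ _ _) ⟨
      ι a K.+ α K.* ev l K.+ α ^ suc w K.* ev r         ∎

  -- Each variable is replaced by the power of a single X whose exponent is its entry in the vector.
  -- When the exponents are steep, the blocks glued together do not overlap.
  kron : ∀ {n} → Vec ℕ n → Poly n → Poly 1
  kron []       a       = a ∷ []
  kron (w ∷ ws) []      = []
  kron (w ∷ ws) (c ∷ p) = glue w (kron ws c) (kron (w ∷ ws) p)

  -- Every block is padded to exactly `w` entries, so the total length is `w` times the number of
  -- outer coefficients, hence at most `D * w`.
  length-kron : ∀ {n D M} (ws : Vec ℕ n) → Steep D ws M →
                ∀ q → Width D n q → length (kron ws q) ≤ M
  length-kron []       ([] 1≤M)    q _         = 1≤M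
  length-kron {suc n} (w ∷ ws) (Dw≤M ∷ st) q (q≤D , _) =
    ℕ.≤-trans (ℕ.≤-reflexive (exact q)) (ℕ.≤-trans (ℕ.*-monoˡ-≤ w q≤D) Dw≤M)
    where
    exact : ∀ (q : Poly (suc n)) → length (kron (w ∷ ws) q) ≡ length q ℕ.* w
    exact []      = refl
    exact (c ∷ q) = trans (length-glue w (kron ws c) _) (cong (w ℕ.+_) (exact q))

  -- By `length-kron` every inner polynomial fits into its block, so no coefficient is lost and all
  -- can be read off again.
  kron-isZero : ∀ {n D M} (ws : Vec ℕ n) → Steep D ws M →
                ∀ q → Width D n q → IsZero 1 (kron ws q) → IsZero n q
  kron-isZero []       _        q _         (q≈0 ∷ []) = q≈0
  kron-isZero {suc n} {D} (w ∷ ws) (_ ∷ st) q (_ , wid) z = go q wid z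
    where
    go : ∀ (q : Poly (suc n)) → All (Width D n) q → IsZero 1 (kron (w ∷ ws) q) → IsZero (suc n) q
    go []      _         _ = []
    go (c ∷ q) (wc ∷ wq) z =
      let z₁ , z₂ = glue-isZero w (kron ws c) _ (length-kron ws st c wc) z
      in kron-isZero ws st c wc z₁ ∷ go q wq z₂

  eval-kron : ∀ α {n D M} (ws : Vec ℕ n) → Steep D ws M → ∀ q → Width D n q →
              eval 1 (kron ws q) (α ∷ []) K.≈ eval n q (map (α ^_) ws)
  eval-kron α []       _        q _         = K.trans (K.+-congˡ (K.zeroʳ α)) (K.+-identityʳ _)
  eval-kron α {suc n} {D} (w ∷ ws) (_ ∷ st) q (_ , wid) = go q wid
    where
    go : ∀ (q : Poly (suc n)) → All (Width D n) q →
         eval 1 (kron (w ∷ ws) q) (α ∷ []) K.≈ eval (suc n) q (map (α ^_) (w ∷ ws))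
    go []      _         = K.refl
    go (c ∷ q) (wc ∷ wq) = K.trans
      (eval-glue α w (kron ws c) _ (length-kron ws st c wc))
      (K.+-cong (eval-kron α ws st c wc) (K.*-congˡ (go q wq)))

  -- Roots and the degree of the minimal polynomial

  coeff-isZero : ∀ p → IsZero 1 p → ∀ k → coeff p k F.≈ F.0#
  coeff-isZero []      _         k       = F.refl
  coeff-isZero (a ∷ p) (a≈0 ∷ _) zero    = a≈0
  coeff-isZero (a ∷ p) (_ ∷ z)   (suc k) = coeff-isZero p z k

  module _ (_≟_ : Decidable F._≈_) where

    -- Decidable equality locates the last nonzero coefficient, scanning down from the top.
    isZero⊎degree : ∀ p → IsZero 1 p ⊎ ∃[ d ] (d < length p × HasDegree p d)
    isZero⊎degree [] = inj₁ []
    isZero⊎degree (a ∷ p) with isZero⊎degree p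
    ... | inj₂ (d , d<p , pd≉0 , above) = inj₂ (suc d , s<s d<p , pd≉0 , above′)
      where
      above′ : ∀ k → suc d < k → coeff (a ∷ p) k F.≈ F.0#
      above′ (suc k) d<k = above k (s<s⁻¹ d<k)
    ... | inj₁ z with a ≟ F.0#
    ...   | yes a≈0 = inj₁ (a≈0 ∷ z)
    ...   | no  a≉0 = inj₂ (0 , z<s , a≉0 , above′)
      where
      above′ : ∀ k → 0 < k → coeff (a ∷ p) k F.≈ F.0#
      above′ (suc k) _ = coeff-isZero p z k

    module _ {deg : K.Carrier → ℕ} (isDeg : IsDegreeMap deg) where

      -- Otherwise `q` would have a degree below `length q`, hence below that of the minimal
      -- polynomial of `α`.
      root-isZero : ∀ α q → length q ≤ deg α → Root q α → IsZero 1 q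
      root-isZero α q q≤deg root with isZero⊎degree q
      ... | inj₁ z = z
      ... | inj₂ (e , e<q , degq) =
        let p , (_ , _ , minimal) , degp = isDeg α
        in ⊥-elim (ℕ.<⇒≱ (ℕ.<-≤-trans e<q q≤deg) (minimal q degp degq root))

      powers-independent : ∀ α {n D} (ws : Vec ℕ n) → Steep D ws (deg α) → ∀ q → Width D n q →
                           eval n q (map (α ^_) ws) K.≈ K.0# → IsZero n q
      powers-independent α ws st q wid e = kron-isZero ws st q wid
        (root-isZero α (kron ws q) (length-kron ws st q wid)
          (K.trans (eval-kron α ws st q wid) e))

-- Recursive functions

mulᶜ : Code 2
mulᶜ = rec zeroᶜ (comp addᶜ (proj 2F ∷ proj 1F ∷ []))

mulᶜ-⇓ : ∀ k a → mulᶜ [ k ∷ a ∷ [] ]⇓ k ℕ.* a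
mulᶜ-⇓ zero    a = ⇓rec0 ⇓zero
mulᶜ-⇓ (suc k) a = ⇓recS (mulᶜ-⇓ k a)
  (⇓comp (⇓proj 2F ∷ ⇓proj 1F ∷ []) (addᶜ-⇓ a (k ℕ.* a)))

-- The exponent is the first argument, the one recursed on.
powerᶜ : Code 2 → ℕ → Code 2
powerᶜ e one = rec (constᶜ one) (comp e (proj 2F ∷ proj 1F ∷ []))

expᶜ : Code 2
expᶜ = powerᶜ mulᶜ 1

expᶜ-⇓ : ∀ k a → expᶜ [ k ∷ a ∷ [] ]⇓ a ℕ.^ k
expᶜ-⇓ zero    a = ⇓rec0 (constᶜ-⇓ 1)
expᶜ-⇓ (suc k) a = ⇓recS (expᶜ-⇓ k a)
  (⇓comp (⇓proj 2F ∷ ⇓proj 1F ∷ []) (mulᶜ-⇓ a (a ℕ.^ k)))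

-- Unbounded search in a computable field

module Search (A : ComputableField) where

  private module A = ComputableField A

  -- The identity on the domain of A and 0# elsewhere, so that the codes of
  -- functions on A can be run on every natural number.
  candidateᶜ : Code 1
  candidateᶜ = comp (rec (constᶜ (proj₁ A.0#)) (proj 2F))
    (proj₁ A.dom-computable ∷ proj 0F ∷ [])

  candidate : ∀ y → ∃[ c ]
    (candidateᶜ [ y ∷ [] ]⇓ proj₁ {B = A.Dom} c × (y ∈ A.Dom → proj₁ c ≡ y))
  candidate y with proj₂ A.dom-computable y
  ... | inj₁ (p , d) = (y , p)
    , ⇓comp (d ∷ ⇓proj 0F ∷ []) (⇓recS (⇓rec0 (constᶜ-⇓ _)) (⇓proj 2F)) , λ _ → refl
  ... | inj₂ (¬p , d) = A.0#
    , ⇓comp (d ∷ ⇓proj 0F ∷ []) (⇓rec0 (constᶜ-⇓ _)) , λ p → ⊥-elim (¬p p)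

  module _ {f : A.Carrier → ℕ} (f-computable : ∃[ e ] ∀ α → e [ proj₁ α ∷ [] ]⇓ f α)
           {b : ℕ → ℕ} (b-computable : ∃[ e ] ∀ i → e [ i ∷ [] ]⇓ b i) where

    private
      fᶜ  = proj₁ f-computable
      f-⇓ = proj₂ f-computable

      -- Truncated subtraction makes the test 0 exactly when the candidate's value under `f` reaches
      -- `b i`.
      testᶜ : Code 2
      testᶜ = comp subᶜ
        (comp fᶜ (comp candidateᶜ (proj 0F ∷ []) ∷ [])
         ∷ comp (proj₁ b-computable) (proj 1F ∷ []) ∷ [])

      test : ∀ y i → testᶜ [ y ∷ i ∷ [] ]⇓ b i ∸ f (proj₁ (candidate y))
      test y i = let c , d , _ = candidate y in ⇓comp
        (⇓comp (⇓comp (⇓proj 0F ∷ []) d ∷ []) (f-⇓ c)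
         ∷ ⇓comp (⇓proj 1F ∷ []) (proj₂ b-computable i) ∷ [])
        (subᶜ-⇓ (f c) (b i))

    searchᶜ : Code 1
    searchᶜ = comp candidateᶜ (μ testᶜ ∷ [])

    search : (∀ n → ∃[ α ] n < f α) →
             ∀ i → ∃[ α ] (searchᶜ [ i ∷ [] ]⇓ proj₁ {B = A.Dom} α × b i ≤ f α)
    search unbounded i with unbounded (b i)
    ... | α , b<fα
      with μ-search (λ y → _ , test y i)
             (subst (testᶜ [ proj₁ α ∷ i ∷ [] ]⇓_) (ℕ.m≤n⇒m∸n≡0 b≤fc) (test (proj₁ α) i))
      where
      same : proj₁ (proj₁ (candidate (proj₁ α))) ≡ proj₁ α
      same = proj₂ (proj₂ (candidate (proj₁ α))) (proj₂ α)

      b≤fc : b i ≤ f (proj₁ (candidate (proj₁ α)))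
      b≤fc = subst (b i ≤_)
        -- An element is a number with a membership proof; as `f` is computed from the number alone,
        -- it takes equal values at `α` and at the candidate.
        (⇓-det (subst (λ y → fᶜ [ y ∷ [] ]⇓ f α) (sym same) (f-⇓ α)) (f-⇓ _)) (ℕ.<⇒≤ b<fα)
    -- The `y` found may lie outside the domain, so its candidate is returned.
    ... | y , d@(⇓μ test≡0 _) = let c , e , _ = candidate y in
      c , ⇓comp (d ∷ []) e , ℕ.m∸n≡0⇒m≤n (⇓-det (test y i) test≡0)

-- Polynomials over the cohesive power at almost every index

⊆*-eventually : {C : Pred ℕ 0ℓ} → ∀ n → C ⊆* (n ≤_)
⊆*-eventually n = upTo n , λ (_ , n≰i) → ∈-upTo⁺ (ℕ.≰⇒> n≰i)

module Pointwise-at (E : ComputableFieldExtension) {C : Pred ℕ 0ℓ} (coh : Cohesive C) where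

  open ComputableFieldExtension E
  open Kronecker extension using (Width)

  private
    module X  = Extension extension
    module Π  = Extension (cohesivePower E coh)
    module ΠF = CohesivePower F coh
    module ΠK = CohesivePower K coh

  -- A relation, because representatives are partial: `q` exists only where all coefficients of `p`
  -- halt.
  PolyAt : ℕ → ∀ n → Π.Poly n → X.Poly n → Set
  PolyAt i zero    φ x = φ ΠF.at i ↦ x
  PolyAt i (suc n) p q = Pointwise (PolyAt i n) p q

  eval-at : ∀ {i} n p {q xs ys} → PolyAt i n p q →
            Vec.Pointwise (λ φ x → φ ΠK.at i ↦ x) xs ys →
            Π.eval n p xs ΠK.at i ↦ X.eval n q ys
  eval-at zero    α       d        Vec.[]       = compose-at E coh α d
  eval-at (suc n) []      []       (d Vec.∷ ds) = ΠK.0-at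
  eval-at (suc n) (c ∷ p) {xs = x ∷ xs} (e ∷ es) (d Vec.∷ ds) =
    ΠK.+-at (Π.eval n c xs) (x ΠK.* Π.eval (suc n) p (x ∷ xs)) (eval-at n c e ds)
      (ΠK.*-at x (Π.eval (suc n) p (x ∷ xs)) d (eval-at (suc n) p es (d Vec.∷ ds)))

  -- Only finitely many coefficients have to halt, and the finitely many list lengths in `p` do not
  -- depend on `i`, so `i` eventually exceeds them all.
  polyAt-defined : ∀ n p → C ⊆* λ i → ∃[ q ] PolyAt i n p q × Width i n q
  polyAt-defined zero    α = ⊆*-map (λ (x , d) → x , d , tt) (ΠF.defined α)
  polyAt-defined (suc n) p = ⊆*-zip
    (λ { {i} (q , d , wid) p≤i → q , d , subst (_≤ i) (Pointwise-length d) p≤i , wid })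
    (coefficients p) (⊆*-eventually (length p))
    where
    coefficients : ∀ p → C ⊆* λ i → ∃[ q ] Pointwise (PolyAt i n) p q × All (Width i n) q
    coefficients []      = ⊆*-all λ _ → [] , [] , []
    coefficients (c ∷ p) = ⊆*-zip
      (λ (a , d , wid) (q , ds , wids) → a ∷ q , d ∷ ds , wid ∷ wids)
      (polyAt-defined n c) (coefficients p)

  isZero-at : ∀ n p → C ⊆* (λ i → ∃[ q ] PolyAt i n p q × X.IsZero n q) → Π.IsZero n p
  isZero-at zero    α       h = ⊆*-map (λ (_ , d , x≐0) → ΠF.agree α ΠF.0# d ΠF.0-at x≐0) h
  isZero-at (suc n) []      h = []
  isZero-at (suc n) (c ∷ p) h =
      isZero-at n c (⊆*-map (λ { (_ ∷ _ , d ∷ _ , z ∷ _) → _ , d , z }) h)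
    ∷ isZero-at (suc n) p (⊆*-map (λ { (_ ∷ _ , _ ∷ d , _ ∷ z) → _ , d , z }) h)

-- The algebraically independent sequence

theorem4p8 : (E : ComputableFieldExtension) →
    let module K = ComputableField (ComputableFieldExtension.K E) in
    (deg : K.Carrier → ℕ) →
    Extension.IsDegreeMap (ComputableFieldExtension.extension E) deg →
    (∃[ e ] (∀ α → e [ proj₁ α ∷ [] ]⇓ deg α)) →
    (C : Pred ℕ 0ℓ) (coh : Cohesive C) →
    (∀ n → ∃[ α ] (n < deg α)) →
    Extension.IsTranscendental (cohesivePower E coh) ×
    Extension.InfiniteTranscendenceDegree (cohesivePower E coh)
theorem4p8 E deg isDeg deg-computable C coh unbounded =
    -- Independence in one variable is transcendence of `x 0`.
    (x 0 , λ (p , p≉0 , root) → p≉0 (independent 1 p root))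
  , x , independent
  where
  open ComputableFieldExtension E
  module K  = ComputableField K
  module ΠK = CohesivePower K coh
  module Π  = Extension (cohesivePower E coh)
  module X  = Extension extension
  open Kronecker extension using (_^_; Width; powers-independent)
  open Pointwise-at E coh
  open Search K

  -- v i 0 bounds deg α_i from below, and v i (suc j) is the exponent of
  -- α_i in x_j.
  v : ℕ → ℕ → ℕ
  v i k = i ℕ.^ (suc i ∸ k)

  -- Consecutive exponents have ratio exactly `i`: for `k < n < i` the subtraction in `v i k` is not
  -- cut off. The last exponent is positive because `i` is.
  v-steep : ∀ {n i} → suc n ≤ i → Steep i (tabulate {n = n} (v i ∘ suc ∘ toℕ)) (v i 0)
  v-steep {n} {i} n<i = steep-tabulate n (v i)
    (λ k k<n → ℕ.≤-reflexive (cong (i ℕ.^_)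
      (sym (ℕ.+-∸-assoc 1 (ℕ.<⇒≤ (ℕ.<-trans k<n n<i))))))
    (ℕ.m^n>0 i {{>-nonZero (ℕ.≤-trans (s≤s z≤n) n<i)}} (suc i ∸ n))

  vᶜ : ℕ → Code 1
  vᶜ k = comp expᶜ (comp subᶜ (constᶜ k ∷ sucᶜ ∷ []) ∷ proj 0F ∷ [])

  vᶜ-⇓ : ∀ k i → vᶜ k [ i ∷ [] ]⇓ v i k
  vᶜ-⇓ k i = ⇓comp
    (⇓comp (constᶜ-⇓ k ∷ ⇓suc ∷ []) (subᶜ-⇓ k (suc i)) ∷ ⇓proj 0F ∷ [])
    (expᶜ-⇓ (suc i ∸ k) i)

  αᶜ : Code 1
  αᶜ = searchᶜ deg-computable (vᶜ 0 , vᶜ-⇓ 0)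

  large : ∀ i → ∃[ α ] (αᶜ [ i ∷ [] ]⇓ proj₁ {B = K.Dom} α × v i 0 ≤ deg α)
  large = search deg-computable (vᶜ 0 , vᶜ-⇓ 0) unbounded

  α : ℕ → K.Carrier
  α i = proj₁ (large i)

  powᶜ : Code 2
  powᶜ = powerᶜ (proj₁ K.*-computable) (proj₁ K.1#)

  powᶜ-⇓ : ∀ k a → powᶜ [ k ∷ proj₁ a ∷ [] ]⇓ proj₁ (a ^ k)
  powᶜ-⇓ zero    a = ⇓rec0 (constᶜ-⇓ _)
  powᶜ-⇓ (suc k) a = ⇓recS (powᶜ-⇓ k a)
    (⇓comp (⇓proj 2F ∷ ⇓proj 1F ∷ []) (proj₂ K.*-computable a (a ^ k)))

  xᶜ : ℕ → Code 1
  xᶜ j = comp powᶜ (vᶜ (suc j) ∷ αᶜ ∷ [])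

  xᶜ-⇓ : ∀ j i → xᶜ j [ i ∷ [] ]⇓ proj₁ (α i ^ v i (suc j))
  xᶜ-⇓ j i = ⇓comp (vᶜ-⇓ (suc j) i ∷ proj₁ (proj₂ (large i)) ∷ []) (powᶜ-⇓ (v i (suc j)) (α i))

  x : ℕ → ΠK.Element
  x j = record
    { code   = xᶜ j
    ; into   = λ {i} d → subst K.Dom (⇓-det (xᶜ-⇓ j i) d) (proj₂ (α i ^ v i (suc j)))
    ; almost = ⊆*-all λ i → _ , xᶜ-⇓ j i
    }

  independent : ∀ n → Π.AlgebraicallyIndependent n (tabulate (x ∘ toℕ))
  independent n p root = isZero-at n p (⊆*-zip
    (λ (q , d , wid) (agreement , n<i) → q , d , vanish q d wid agreement n<i)
    (polyAt-defined n p) (⊆*-zip _,_ root (⊆*-eventually (suc n))))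
    where
    vanish : ∀ {i} q → PolyAt i n p q → Width i n q →
             ΠK.Agree (Π.eval n p (tabulate (x ∘ toℕ))) ΠK.0# i → suc n ≤ i → X.IsZero n q
    vanish {i} q d wid (_ , e , e₀) n<i =
      powers-independent (λ a b → proj₁ a ℕ.≟ proj₁ b) isDeg (α i) ws
        -- The search made `deg (α i)` at least `v i 0`, the bound for which the exponents are
        -- steep.
        (steep-mono (v-steep n<i) (proj₂ (proj₂ (large i)))) q wid
        (subst (λ ys → X.eval n q ys ≐ K.0#) (tabulate-∘ (α i ^_) (v i ∘ suc ∘ toℕ))
          -- Agreement with `ΠK.0#` at `i` concerns outputs of codes; determinism identifies these
          -- with the evaluation in `K` and with `K.0#`.
          (trans (⇓-det (ΠK._at_↦_.value value) e) (⇓-det e₀ (constᶜ-⇓ _))))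
      where
      ws : Vec ℕ n
      ws = tabulate (v i ∘ suc ∘ toℕ)

      value : Π.eval n p (tabulate (x ∘ toℕ)) ΠK.at i ↦
              X.eval n q (tabulate ((α i ^_) ∘ v i ∘ suc ∘ toℕ))
      value = eval-at n p d (Vec.tabulate⁺ λ k → ΠK.run (xᶜ-⇓ (toℕ k) i))
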